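{- Let $\mathcal{F}$ be a class of simple graphs and consider the assertions: (1) $\mathcal{F}$ is closed under edge contractions; (2) $\equiv_{\mathcal{F}}$ is preserved under right lexicographic products, i.e.\ for all simple graphs $G,G',H$, if $G\equiv_{\mathcal{F}}G'$ then $G\cdot H\equiv_{\mathcal{F}}G'\cdot H$; (3) $\mathrm{cl}(\mathcal{F})$ is closed under edge contractions. Then (1) implies (2), and (2) and (3) are equivalent.
   Context: All graphs are finite, undirected, without multiple edges; simple means without loops. $\hom(F,G)$ counts homomorphisms $F\to G$; $G\equiv_{\mathcal{F}}H$ means $\hom(F,G)=\hom(F,H)$ for all $F\in\mathcal{F}$; $\mathrm{cl}(\mathcal{F})$ is the class of all simple graphs $K$ such that for all simple $G,H$, $G\equiv_{\mathcal{F}}H$ implies $\hom(K,G)=\hom(K,H)$. The lexicographic product $G\cdot H$ has vertex set $V(G)\times V(H)$, with $(g,h)$ adjacent to $(g',h')$ iff either $g=g'$ and $hh'\in E(H)$, or $gg'\in E(G)$. For a partition $\mathcal{P}$ of $V(F)$, $F/\mathcal{P}$ is the simple graph on $\mathcal{P}$ with an edge $PQ$ ($P\neq Q$) iff some $p\in P,q\in Q$ are adjacent in $F$; a class is closed under edge contractions if it contains every graph isomorphic to $F/\mathcal{P}$ for $F$ in the class and $\mathcal{P}$ a partition of $V(F)$ with $F[P]$ connected for all $P\in\mathcal{P}$. -}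

module Defs where

open import Level using (0ℓ; _⊔_) renaming (suc to lsuc)
open import Data.Nat using (ℕ; _*_; _^_)
open import Data.Fin using (Fin; remQuot; finToFun)
open import Data.Fin.Properties using (_≟_; any?; all?)
open import Data.List using (length; filter; allFin)
open import Data.Product using (Σ; ∃; _×_; _,_; proj₁; proj₂)
open import Data.Sum using (_⊎_; inj₁; inj₂)
open import Function using (_on_; _⇔_; _↔_; Inverse; StrictlySurjective)
open import Relation.Binary using (Rel; Decidable; Symmetric; Irreflexive)
open import Relation.Binary.Construct.Closure.ReflexiveTransitive using (Star)
open import Relation.Binary.PropositionalEquality using (_≡_; _≢_; refl; sym)
open import Relation.Nullary using (Dec; ¬?; _×-dec_; _⊎-dec_; _→-dec_)
open import Relation.Unary using (Pred; _∈_)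

record SimpleGraph : Set₁ where
  field
    order  : ℕ
    Adj    : Rel (Fin order) 0ℓ
    adj?   : Decidable Adj
    symm   : Symmetric Adj
    irrefl : Irreflexive _≡_ Adj

  V : Set
  V = Fin order

open SimpleGraph public

IsHom : (F G : SimpleGraph) → (V F → V G) → Set
IsHom F G f = ∀ u v → Adj F u v → Adj G (f u) (f v)

isHom? : (F G : SimpleGraph) (f : V F → V G) → Dec (IsHom F G f)
isHom? F G f = all? λ u → all? λ v → adj? F u v →-dec adj? G (f u) (f v)

-- finToFun enumerates the maps V F → V G, each exactly once, by the
-- elements of Fin (order G ^ order F).
hom : SimpleGraph → SimpleGraph → ℕ
hom F G =
  length (filter (λ i → isHom? F G (finToFun i)) (allFin (order G ^ order F)))

infix 4 _≡[_]_ _≅_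

_≡[_]_ : ∀ {ℓ} → SimpleGraph → Pred SimpleGraph ℓ → SimpleGraph → Set (lsuc 0ℓ ⊔ ℓ)
G ≡[ 𝓕 ] H = ∀ F → F ∈ 𝓕 → hom F G ≡ hom F H

cl : ∀ {ℓ} → Pred SimpleGraph ℓ → Pred SimpleGraph (lsuc 0ℓ ⊔ ℓ)
cl 𝓕 K = ∀ G H → G ≡[ 𝓕 ] H → hom K G ≡ hom K H

record _≅_ (G H : SimpleGraph) : Set where
  field
    bijection : V G ↔ V H
  open Inverse bijection public using (to; from)
  field
    adj⇔ : ∀ u v → Adj G u v ⇔ Adj H (to u) (to v)

LexAdj : (G H : SimpleGraph) → Rel (V G × V H) 0ℓ
LexAdj G H (g , h) (g′ , h′) = (g ≡ g′ × Adj H h h′) ⊎ Adj G g g′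

infixl 7 _·_

-- remQuot is the bijection Fin (m * n) → Fin m × Fin n.
_·_ : SimpleGraph → SimpleGraph → SimpleGraph
G · H = record
  { order  = order G * order H
  ; Adj    = LexAdj G H on remQuot (order H)
  ; adj?   = λ x y →
      let (g , h) = remQuot (order H) x
          (g′ , h′) = remQuot (order H) y
      in ((g ≟ g′) ×-dec adj? H h h′) ⊎-dec adj? G g g′
  ; symm   = λ where
      (inj₁ (g≡g′ , hh′)) → inj₁ (sym g≡g′ , symm H hh′)
      (inj₂ gg′)          → inj₂ (symm G gg′)
  ; irrefl = λ where
      refl (inj₁ (_ , hh)) → irrefl H refl hh
      refl (inj₂ gg)       → irrefl G refl gg
  }

-- A partition into parts indexed by Fin size: part p is the fibre
-- { v | part v ≡ p }, and surjectivity says that no part is empty.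
record Partition (F : SimpleGraph) : Set where
  field
    size       : ℕ
    part       : V F → Fin size
    surjective : StrictlySurjective _≡_ part

open Partition public

Connected : {A : Set} → Rel A 0ℓ → Set
Connected E = ∀ u v → Star E u v

Part : {F : SimpleGraph} (𝓟 : Partition F) → Fin (size 𝓟) → Set
Part {F} 𝓟 p = Σ (V F) λ v → part 𝓟 v ≡ p

ConnectedParts : {F : SimpleGraph} → Partition F → Set
ConnectedParts {F} 𝓟 = ∀ p → Connected {Part 𝓟 p} (Adj F on proj₁)

infixl 7 _/_

_/_ : (F : SimpleGraph) → Partition F → SimpleGraph
F / 𝓟 = record
  { order  = size 𝓟
  ; Adj    = λ P Q → P ≢ Q ×
      ∃ λ p → ∃ λ q → part 𝓟 p ≡ P × part 𝓟 q ≡ Q × Adj F p q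
  ; adj?   = λ P Q → ¬? (P ≟ Q) ×-dec
      any? λ p → any? λ q →
        (part 𝓟 p ≟ P) ×-dec ((part 𝓟 q ≟ Q) ×-dec adj? F p q)
  ; symm   = λ (P≢Q , p , q , p∈P , q∈Q , pq) →
      (λ Q≡P → P≢Q (sym Q≡P)) , q , p , q∈Q , p∈P , symm F pq
  ; irrefl = λ P≡Q (P≢Q , _) → P≢Q P≡Q
  }

ClosedUnderEdgeContractions : ∀ {ℓ} → Pred SimpleGraph ℓ → Set (lsuc 0ℓ ⊔ ℓ)
ClosedUnderEdgeContractions 𝓕 =
  ∀ F → F ∈ 𝓕 → (𝓟 : Partition F) → ConnectedParts 𝓟 →
  ∀ K → K ≅ F / 𝓟 → K ∈ 𝓕

PreservedUnderRightLexProducts : ∀ {ℓ} → Pred SimpleGraph ℓ → Set (lsuc 0ℓ ⊔ ℓ)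
PreservedUnderRightLexProducts 𝓕 =
  ∀ G G′ H → G ≡[ 𝓕 ] G′ → G · H ≡[ 𝓕 ] G′ · H

{-# OPTIONS --safe #-}
module Submission where

-- A homomorphism F → G · H is a pair of maps a : V F → V G, b : V F → V H.  Sorting
-- these pairs by the set r of edges of F that a makes monochromatic gives
--   hom F (G · H) = Σ_r contractions F r G * preservations F r H,
-- where contractions F r G is hom (F / 𝓟) G if r consists of the edges inside the parts
-- of a partition 𝓟 with connected parts, and 0 otherwise.  Closure of 𝓕 under edge
-- contractions thus makes both sides depend on G only up to ≡[ 𝓕 ].
--
-- Conversely, ≡[ 𝓕 ] is always preserved by the categorical product G ⊗ X, in which the
-- numbers x r = contractions F r G are multiplicative.  For G ≡[ 𝓕 ] G′, F ∈ cl 𝓕 and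
-- y r = contractions F r G′, expanding hom F ((G ⊗ X) · F) = hom F ((G′ ⊗ X) · F) for
-- X = G and for X = G′ yields Σ_r (x r − y r)² * preservations F r F = 0.  The weight is
-- positive for r ⊆ E(F), because of the identity map, so x r = y r.

open import Defs
open import Data.Bool using (if_then_else_)
open import Data.Empty using (⊥-elim)
open import Data.Fin using (Fin; zero; suc; _↑ˡ_; _↑ʳ_; combine; remQuot; finToFun; funToFin; punchIn; punchOut)
open import Data.Fin.Patterns using (0F; 1F)
open import Data.Fin.Properties using (_≟_; any?; all?; remQuot-combine; combine-remQuot; finToFun-funToFin; funToFin-finToFin; punchInᵢ≢i; punchOut-punchIn; punchOut-cong; punchOut-injective)
open import Data.List using (length; filter; tabulate)
open import Data.Nat using (ℕ; zero; suc; _+_; _*_; _^_; _≤_; z≤n; NonZero; ∣_-_∣)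
open import Data.Nat.Properties using (+-*-semiring; +-identityʳ; +-assoc; +-comm; +-cancelˡ-≡; +-cancelʳ-≤; +-mono-≤; +-monoʳ-≤; *-distribʳ-+; *-cancelʳ-≡; *-monoˡ-≤; ≤-antisym; ≤-total; m≤m+n; m≤n⇒∃[o]m+o≡n; m*n≡0⇒m≡0∨n≡0; ∣-∣-comm; ∣m-m+n∣≡n; ∣m-n∣≡0⇒m≡n; module ≤-Reasoning)
open import Data.Nat.Solver using (module +-*-Solver)
open import Data.Product using (Σ; ∃; _×_; _,_; proj₁; proj₂; map₂)
open import Data.Sum using (_⊎_; inj₁; inj₂)
open import Function using (_∘_; _on_; id; StrictlySurjective; _⇔_; mk⇔; _↔_; mk↔ₛ′; Equivalence; Inverse)
open import Function.Construct.Identity using (⇔-id; ↔-id)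
open import Function.Properties.Equivalence using () renaming (sym to ⇔-sym; trans to ⇔-trans)
open import Level using (0ℓ)
open import Relation.Binary using (Rel; Decidable)
open import Relation.Binary.Construct.Closure.Equivalence using (EqClosure; symmetric; return; gfold)
open import Relation.Binary.Construct.Closure.ReflexiveTransitive using (Star; ε; _◅_; _◅◅_)
open import Relation.Binary.Construct.Closure.Symmetric using (SymClosure; fwd; bwd)
open import Relation.Binary.PropositionalEquality using (_≡_; _≢_; _≗_; refl; sym; trans; cong; cong₂; subst; subst₂; isEquivalence; module ≡-Reasoning)
open import Relation.Nullary using (Dec; yes; no; does; ¬_; ¬?; contradiction; _×-dec_; _⊎-dec_; _→-dec_)
open import Relation.Nullary.Decidable using (does-⇔; dec-true; dec-false)
open import Relation.Unary using (Pred; _∈_)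
import Data.Sum
import Relation.Unary as U

open import Algebra.Properties.Semiring.Sum +-*-semiring using (sum; sum-cong-≗; sum-replicate-zero; sum-remove; sum-permute; ∑-comm; ∑-distrib-+; *-distribˡ-sum; *-distribʳ-sum)

private
  variable
    k l m n : ℕ
    A B : Set

-- Finite sums of natural numbers.

sum-+ : (t : Fin (m + n) → ℕ) →
  sum t ≡ sum (λ i → t (i ↑ˡ n)) + sum (λ j → t (m ↑ʳ j))
sum-+ {zero}  t = refl
sum-+ {suc m} t = trans (cong (t zero +_) (sum-+ {m} (t ∘ suc))) (sym (+-assoc (t zero) _ _))

sum-combine : (t : Fin (m * n) → ℕ) →
  sum t ≡ sum λ (i : Fin m) → sum λ (j : Fin n) → t (combine i j)
sum-combine {zero}      t = refl
sum-combine {suc m} {n} t =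
  trans (sum-+ {n} t) (cong (sum (λ j → t (j ↑ˡ m * n)) +_) (sum-combine {m} _))

sum-* : (s : Fin m → ℕ) (t : Fin n → ℕ) →
  sum s * sum t ≡ sum λ i → sum λ j → s i * t j
sum-* s t = trans (*-distribʳ-sum (sum t) s) (sum-cong-≗ λ i → *-distribˡ-sum (s i) t)

sum-mono-≤ : {s t : Fin n → ℕ} → (∀ i → s i ≤ t i) → sum s ≤ sum t
sum-mono-≤ {zero}  s≤t = z≤n
sum-mono-≤ {suc n} s≤t = +-mono-≤ (s≤t zero) (sum-mono-≤ (s≤t ∘ suc))

-- Bounding all terms but the `i`-th and cancelling them leaves `t i ≤ s i`. This replaces the
-- argument that a vanishing sum of nonnegative differences has only zero terms, without
-- subtraction.
sum-≤-≡ : {s t : Fin n → ℕ} → (∀ i → s i ≤ t i) → sum s ≡ sum t → s ≗ t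
sum-≤-≡ {suc n} {s} {t} s≤t Σs≡Σt i = ≤-antisym (s≤t i) (+-cancelʳ-≤ (sum (s ∘ punchIn i)) (t i) (s i) t≤s)
  where
  t≤s : t i + sum (s ∘ punchIn i) ≤ s i + sum (s ∘ punchIn i)
  t≤s = begin
    t i + sum (s ∘ punchIn i)  ≤⟨ +-monoʳ-≤ (t i) (sum-mono-≤ (s≤t ∘ punchIn i)) ⟩
    t i + sum (t ∘ punchIn i)  ≡⟨ sum-remove t ⟨
    sum t                      ≡⟨ Σs≡Σt ⟨
    sum s                      ≡⟨ sum-remove s ⟩
    s i + sum (s ∘ punchIn i)  ∎
    where open ≤-Reasoning

-- Indicators and counting by sums.

𝟙 : Dec A → ℕ
𝟙 a? = if does a? then 1 else 0

𝟙-⇔ : A ⇔ B → (a? : Dec A) (b? : Dec B) → 𝟙 a? ≡ 𝟙 b?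
𝟙-⇔ A⇔B a? b? = cong (if_then 1 else 0) (does-⇔ A⇔B a? b?)

𝟙-yes : (a? : Dec A) → A → 𝟙 a? ≡ 1
𝟙-yes a? a = cong (if_then 1 else 0) (dec-true a? a)

𝟙-no : (a? : Dec A) → ¬ A → 𝟙 a? ≡ 0
𝟙-no a? ¬a = cong (if_then 1 else 0) (dec-false a? ¬a)

𝟙-× : (a? : Dec A) (b? : Dec B) → 𝟙 (a? ×-dec b?) ≡ 𝟙 a? * 𝟙 b?
𝟙-× (yes _) b? = sym (+-identityʳ (𝟙 b?))
𝟙-× (no  _) b? = refl

count : {P : Fin n → Set} → U.Decidable P → ℕ
count P? = sum λ i → 𝟙 (P? i)

count-none : {P : Fin n → Set} (P? : U.Decidable P) → (∀ i → ¬ P i) → count P? ≡ 0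
count-none {n} P? ¬P = trans (sum-cong-≗ λ i → 𝟙-no (P? i) (¬P i)) (sum-replicate-zero n)

count-remove : {P : Fin (suc n) → Set} (P? : U.Decidable P) → ∀ {i} → P i →
  count P? ≡ 1 + count (P? ∘ punchIn i)
count-remove P? {i} Pi =
  trans (sum-remove {i = i} (λ j → 𝟙 (P? j))) (cong (_+ count (P? ∘ punchIn i)) (𝟙-yes (P? i) Pi))

count-nonZero : {P : Fin n → Set} (P? : U.Decidable P) → ∀ {i} → P i → NonZero (count P?)
count-nonZero {suc n} P? {i} Pi = subst NonZero (sym (count-remove P? Pi)) _

-- Uniqueness leaves at most one nonzero summand, and `A` decides whether there is one. Such
-- collapses let a double sum be read by rows or by columns.
count-unique : {P : Fin n → Set} (P? : U.Decidable P) (a? : Dec A) →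
  (∀ {i} → P i → A) → (∀ {i j} → P i → P j → i ≡ j) → (A → ∃ P) →
  count P? ≡ 𝟙 a?
count-unique P? (no ¬a) P⇒A _ _ = count-none P? λ i → ¬a ∘ P⇒A
count-unique {n = zero} P? (yes a) _ _ ∃P with () ← proj₁ (∃P a)
count-unique {n = suc n} P? (yes a) _ P! ∃P with i , Pi ← ∃P a =
  trans (count-remove P? Pi)
        (cong suc (count-none (P? ∘ punchIn i) λ j Pj → punchInᵢ≢i i j (P! Pj Pi)))

-- Double counting of the pairs in `R`: a row `i` contains one pair if `P i` and none otherwise, and
-- likewise a column `j` for `Q j`.
count-matching : {P : Fin m → Set} {Q : Fin n → Set} {R : Fin m → Fin n → Set}
  (P? : U.Decidable P) (Q? : U.Decidable Q) (R? : ∀ i j → Dec (R i j)) →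
  (∀ {i j} → R i j → P i × Q j) →
  (∀ {i j j′} → R i j → R i j′ → j ≡ j′) →
  (∀ {i i′ j} → R i j → R i′ j → i ≡ i′) →
  (∀ {i} → P i → ∃ λ j → R i j) →
  (∀ {j} → Q j → ∃ λ i → R i j) →
  count P? ≡ count Q?
count-matching P? Q? R? R⇒PQ R-functional R-injective R-total R-surjective = begin
  count P?                          ≡⟨ sum-cong-≗ (λ i → count-unique (R? i) (P? i) (proj₁ ∘ R⇒PQ) R-functional R-total) ⟨
  sum (λ i → sum λ j → 𝟙 (R? i j))  ≡⟨ ∑-comm (λ i j → 𝟙 (R? i j)) ⟩
  sum (λ j → sum λ i → 𝟙 (R? i j))  ≡⟨ sum-cong-≗ (λ j → count-unique (λ i → R? i j) (Q? j) (proj₂ ∘ R⇒PQ) R-injective R-surjective) ⟩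
  count Q?                          ∎
  where open ≡-Reasoning

length-filter-tabulate : {P : A → Set} (P? : U.Decidable P) (f : Fin n → A) →
  length (filter P? (tabulate f)) ≡ count (P? ∘ f)
length-filter-tabulate {n = zero}  P? f = refl
length-filter-tabulate {n = suc n} P? f with P? (f zero)
... | yes _ = cong suc (length-filter-tabulate P? (f ∘ suc))
... | no  _ = length-filter-tabulate P? (f ∘ suc)

-- Counting maps between finite sets.

Map : ℕ → ℕ → Set
Map n m = Fin n → Fin m

funToFin-cong : {f g : Map n m} → f ≗ g → funToFin f ≡ funToFin g
funToFin-cong {zero}  f≗g = refl
funToFin-cong {suc n} f≗g = cong₂ combine (f≗g zero) (funToFin-cong (f≗g ∘ suc))

finToFun-injective : {i j : Fin (m ^ n)} → finToFun {m} {n} i ≗ finToFun j → i ≡ j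
finToFun-injective {m} {n} {i} {j} i≗j =
  trans (sym (funToFin-finToFin {n} {m} i)) (trans (funToFin-cong i≗j) (funToFin-finToFin {n} {m} j))

countMaps : {P : Map n m → Set} → (∀ f → Dec (P f)) → ℕ
countMaps {n} {m} P? = count λ (i : Fin (m ^ n)) → P? (finToFun i)

-- Only the decoded maps `finToFun i` are counted, and an arbitrary map agrees with its decoded code
-- merely pointwise. A predicate must therefore be transported along `≗`.
Extensional : (Map n m → Set) → Set
Extensional P = ∀ {f g} → f ≗ g → P f → P g

-- The codes `i` and `j` are matched when `φ` carries the map of `i` pointwise to that of `j`.
-- Injectivity and surjectivity matter only between `P` and `Q`, up to `≗`.
countMaps-bijection : {P : Map n m → Set} {Q : Map k l → Set}
  (P? : ∀ f → Dec (P f)) (Q? : ∀ f → Dec (Q f)) →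
  Extensional P → Extensional Q →
  (φ : Map n m → Map k l) → (∀ {f g} → f ≗ g → φ f ≗ φ g) →
  (∀ {f} → P f → Q (φ f)) →
  (∀ {f g} → P f → P g → φ f ≗ φ g → f ≗ g) →
  (∀ {g} → Q g → ∃ λ f → P f × φ f ≗ g) →
  countMaps P? ≡ countMaps Q?
countMaps-bijection {n} {m} {k} {l} {P} {Q} P? Q? P-ext Q-ext φ φ-cong P⇒Q φ-inj φ-surj =
  count-matching (λ i → P? (finToFun i)) (λ j → Q? (finToFun j))
    (λ i j → P? (finToFun i) ×-dec all? λ u → φ (finToFun i) u ≟ finToFun j u)
    (λ (Pi , i↦j) → Pi , Q-ext i↦j (P⇒Q Pi))
    (λ (_ , i↦j) (_ , i↦j′) → finToFun-injective {l} {k} λ u → trans (sym (i↦j u)) (i↦j′ u))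
    (λ (Pi , i↦j) (Pi′ , i′↦j) → finToFun-injective {m} {n} (φ-inj Pi Pi′ λ u → trans (i↦j u) (sym (i′↦j u))))
    (λ {i} Pi → funToFin (φ (finToFun i)) , Pi , λ u → sym (finToFun-funToFin _ u))
    λ Qj → let f , Pf , f↦j = φ-surj Qj
               f≗ = λ u → sym (finToFun-funToFin f u)
           in funToFin f , P-ext f≗ Pf , λ u → trans (sym (φ-cong f≗ u)) (f↦j u)

-- Maps into a product as pairs of maps.

module _ {n k l : ℕ} where

  private
    fstMap : Fin ((k * l) ^ n) → Map n k
    fstMap i u = proj₁ (remQuot {k} l (finToFun {k * l} {n} i u))

    sndMap : Fin ((k * l) ^ n) → Map n l
    sndMap i u = proj₂ (remQuot {k} l (finToFun {k * l} {n} i u))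

    pairing : Map n k → Map n l → Fin ((k ^ n) * (l ^ n))
    pairing a b = combine (funToFin a) (funToFin b)

    π₁ : Fin ((k ^ n) * (l ^ n)) → Map n k
    π₁ j = finToFun {k} {n} (proj₁ (remQuot {k ^ n} (l ^ n) j))

    π₂ : Fin ((k ^ n) * (l ^ n)) → Map n l
    π₂ j = finToFun {l} {n} (proj₂ (remQuot {k ^ n} (l ^ n) j))

    π₁-pairing : ∀ a b → π₁ (pairing a b) ≗ a
    π₁-pairing a b u = trans
      (cong (λ q → finToFun {k} {n} (proj₁ q) u) (remQuot-combine {k ^ n} {l ^ n} (funToFin a) (funToFin b)))
      (finToFun-funToFin a u)

    π₂-pairing : ∀ a b → π₂ (pairing a b) ≗ b
    π₂-pairing a b u = trans
      (cong (λ q → finToFun {l} {n} (proj₂ q) u) (remQuot-combine {k ^ n} {l ^ n} (funToFin a) (funToFin b)))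
      (finToFun-funToFin b u)

  -- The law of exponents at the level of codes, in the form that allows reindexing a sum: decode,
  -- split or join the values, encode again.
  mapsToProduct : Fin ((k * l) ^ n) ↔ Fin ((k ^ n) * (l ^ n))
  mapsToProduct = mk↔ₛ′ to from to-from from-to
    where
    to : Fin ((k * l) ^ n) → Fin ((k ^ n) * (l ^ n))
    to i = pairing (fstMap i) (sndMap i)

    combined : Fin ((k ^ n) * (l ^ n)) → Map n (k * l)
    combined j u = combine (π₁ j u) (π₂ j u)

    from : Fin ((k ^ n) * (l ^ n)) → Fin ((k * l) ^ n)
    from j = funToFin (combined j)

    remQuot-from : ∀ j u → remQuot {k} l (finToFun {k * l} {n} (from j) u) ≡ (π₁ j u , π₂ j u)
    remQuot-from j u =
      trans (cong (remQuot {k} l) (finToFun-funToFin (combined j) u)) (remQuot-combine (π₁ j u) (π₂ j u))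

    to-from : ∀ j → to (from j) ≡ j
    to-from j = trans
      (cong₂ combine
        (trans (funToFin-cong (cong proj₁ ∘ remQuot-from j)) (funToFin-finToFin {n} {k} _))
        (trans (funToFin-cong (cong proj₂ ∘ remQuot-from j)) (funToFin-finToFin {n} {l} _)))
      (combine-remQuot {k ^ n} (l ^ n) j)

    from-to : ∀ i → from (to i) ≡ i
    from-to i = finToFun-injective {k * l} {n} λ u → begin
      finToFun {k * l} {n} (from (to i)) u   ≡⟨ finToFun-funToFin (combined (to i)) u ⟩
      combine (π₁ (to i) u) (π₂ (to i) u)    ≡⟨ cong₂ combine (π₁-pairing (fstMap i) (sndMap i) u) (π₂-pairing (fstMap i) (sndMap i) u) ⟩
      combine (fstMap i u) (sndMap i u)      ≡⟨ combine-remQuot {k} l (finToFun {k * l} {n} i u) ⟩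
      finToFun {k * l} {n} i u               ∎
      where open ≡-Reasoning

  sum-mapsToProduct : (φ : Map n k → Map n l → ℕ) →
    (∀ {a a′ b b′} → a ≗ a′ → b ≗ b′ → φ a b ≡ φ a′ b′) →
    sum (λ (i : Fin ((k * l) ^ n)) →
      φ (proj₁ ∘ remQuot {k} l ∘ finToFun i) (proj₂ ∘ remQuot {k} l ∘ finToFun i))
    ≡ sum λ (i : Fin (k ^ n)) → sum λ (j : Fin (l ^ n)) → φ (finToFun i) (finToFun j)
  sum-mapsToProduct φ φ-cong = begin
    sum (λ i → φ (fstMap i) (sndMap i))
      ≡⟨ sum-cong-≗ {(k * l) ^ n} (λ i → φ-cong (π₁-pairing (fstMap i) (sndMap i)) (π₂-pairing (fstMap i) (sndMap i))) ⟨
    sum (ψ ∘ Inverse.to mapsToProduct)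
      ≡⟨ sum-permute ψ mapsToProduct ⟨
    sum ψ
      ≡⟨ sum-combine {k ^ n} {l ^ n} ψ ⟩
    sum (λ (i : Fin (k ^ n)) → sum λ (j : Fin (l ^ n)) → ψ (combine i j))
      ≡⟨ sum-cong-≗ {k ^ n} (λ i → sum-cong-≗ {l ^ n} λ j →
           cong (λ q → φ (finToFun (proj₁ q)) (finToFun (proj₂ q))) (remQuot-combine {k ^ n} {l ^ n} i j)) ⟩
    sum (λ (i : Fin (k ^ n)) → sum λ (j : Fin (l ^ n)) → φ (finToFun i) (finToFun j)) ∎
    where
    open ≡-Reasoning
    ψ : Fin ((k ^ n) * (l ^ n)) → ℕ
    ψ j = φ (π₁ j) (π₂ j)

  countMaps-× : {P : Map n k → Set} {Q : Map n l → Set} {R : Map n (k * l) → Set}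
    (P? : ∀ f → Dec (P f)) (Q? : ∀ f → Dec (Q f)) (R? : ∀ f → Dec (R f)) →
    Extensional P → Extensional Q →
    (∀ f → R f ⇔ (P (proj₁ ∘ remQuot {k} l ∘ f) × Q (proj₂ ∘ remQuot {k} l ∘ f))) →
    countMaps R? ≡ countMaps P? * countMaps Q?
  countMaps-× P? Q? R? P-ext Q-ext R⇔ = begin
    countMaps R?
      ≡⟨ sum-cong-≗ {(k * l) ^ n} (λ i → trans (𝟙-⇔ (R⇔ (finToFun i)) (R? _) (P? _ ×-dec Q? _)) (𝟙-× (P? _) (Q? _))) ⟩
    sum (λ (i : Fin ((k * l) ^ n)) →
      φ (proj₁ ∘ remQuot {k} l ∘ finToFun i) (proj₂ ∘ remQuot {k} l ∘ finToFun i))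
      ≡⟨ sum-mapsToProduct φ (λ a≗ b≗ → cong₂ _*_
           (𝟙-⇔ (mk⇔ (P-ext a≗) (P-ext (sym ∘ a≗))) (P? _) (P? _))
           (𝟙-⇔ (mk⇔ (Q-ext b≗) (Q-ext (sym ∘ b≗))) (Q? _) (Q? _))) ⟩
    sum (λ (i : Fin (k ^ n)) → sum λ (j : Fin (l ^ n)) → φ (finToFun i) (finToFun j))
      ≡⟨ sum-* {k ^ n} {l ^ n} (λ i → 𝟙 (P? (finToFun i))) (λ j → 𝟙 (Q? (finToFun j))) ⟨
    countMaps P? * countMaps Q? ∎
    where
    open ≡-Reasoning
    φ = λ a b → 𝟙 (P? a) * 𝟙 (Q? b)

-- Decidable relations on a finite set.

-- r codes a Boolean matrix, one code per decidable relation up to ⇔.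
⟦_⟧ : Fin ((2 ^ n) ^ n) → Rel (Fin n) 0ℓ
⟦_⟧ {n} r u v = finToFun {2} {n} (finToFun {2 ^ n} {n} r u) v ≡ 1F

⟦_⟧? : (r : Fin ((2 ^ n) ^ n)) → Decidable (⟦_⟧ {n} r)
⟦_⟧? {n} r u v = finToFun {2} {n} (finToFun {2 ^ n} {n} r u) v ≟ 1F

⟦⟧-injective : {r s : Fin ((2 ^ n) ^ n)} → (∀ u v → ⟦_⟧ {n} r u v ⇔ ⟦_⟧ {n} s u v) → r ≡ s
⟦⟧-injective {n} r⇔s = finToFun-injective {2 ^ n} {n} λ u → finToFun-injective {2} {n} λ v → bits (r⇔s u v)
  where
  bits : {x y : Fin 2} → x ≡ 1F ⇔ y ≡ 1F → x ≡ y
  bits {0F} {0F} _ = refl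
  bits {0F} {1F} x⇔y = Equivalence.from x⇔y refl
  bits {1F} {y}  x⇔y = sym (Equivalence.to x⇔y refl)

⟦⟧-surjective : {R : Rel (Fin n) 0ℓ} → Decidable R → ∃ λ r → ∀ u v → ⟦_⟧ {n} r u v ⇔ R u v
⟦⟧-surjective {n} {R} R? = funToFin (funToFin ∘ bit) , λ u v → subst (λ x → x ≡ 1F ⇔ R u v) (sym (bit-eq u v)) (bit⇔ (R? u v))
  where
  toBit : Dec A → Fin 2
  toBit a? = if does a? then 1F else 0F

  bit : Fin n → Fin n → Fin 2
  bit u v = toBit (R? u v)

  bit-eq : ∀ u v → finToFun {2} {n} (finToFun {2 ^ n} {n} (funToFin (funToFin ∘ bit)) u) v ≡ bit u v
  bit-eq u v = trans (cong (λ x → finToFun {2} {n} x v) (finToFun-funToFin (funToFin ∘ bit) u)) (finToFun-funToFin (bit u) v)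

  bit⇔ : (a? : Dec A) → toBit a? ≡ 1F ⇔ A
  bit⇔ (yes a) = mk⇔ (λ _ → a) (λ _ → refl)
  bit⇔ (no ¬a) = mk⇔ (λ ()) (λ a → contradiction a ¬a)

-- Homomorphisms into a lexicographic product, sorted by marking.

hom≡countMaps : ∀ F G → hom F G ≡ countMaps (isHom? F G)
hom≡countMaps F G = length-filter-tabulate (λ i → isHom? F G (finToFun i)) id

isHom-extensional : ∀ F G → Extensional (IsHom F G)
isHom-extensional F G f≗g f-hom u v uv = subst₂ (Adj G) (f≗g u) (f≗g v) (f-hom u v uv)

module _ (F : SimpleGraph) (M : Rel (V F) 0ℓ) where

  -- This says that `M` is exactly the set of monochromatic edges of `a` and that `a` sends the
  -- other edges to edges. Maximality of `M` is not spelled out, since it follows from `G` being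
  -- loopless.
  Contracts : (G : SimpleGraph) → (V F → V G) → Set
  Contracts G a = ∀ u v →
    (M u v → Adj F u v × a u ≡ a v) × (Adj F u v → M u v ⊎ Adj G (a u) (a v))

  Preserves : (H : SimpleGraph) → (V F → V H) → Set
  Preserves H b = ∀ u v → M u v → Adj H (b u) (b v)

  contracts-extensional : ∀ G → Extensional (Contracts G)
  contracts-extensional G a≗b a-con u v =
    let M⇒ , adj⇒ = a-con u v
    in map₂ (subst₂ _≡_ (a≗b u) (a≗b v)) ∘ M⇒ ,
       Data.Sum.map₂ (subst₂ (Adj G) (a≗b u) (a≗b v)) ∘ adj⇒

  -- An unmarked edge goes to an edge of `G`, whose ends differ. Hence `a` determines `M`.
  contracts⇒monochromatic : ∀ G {a} → Contracts G a →
    ∀ u v → M u v ⇔ (Adj F u v × a u ≡ a v)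
  contracts⇒monochromatic G a-con u v = mk⇔ (proj₁ (a-con u v)) λ (uv , au≡av) →
    Data.Sum.fromInj₁ (⊥-elim ∘ irrefl G au≡av) (proj₂ (a-con u v) uv)

  module _ (M? : Decidable M) where

    contracts? : ∀ G a → Dec (Contracts G a)
    contracts? G a = all? λ u → all? λ v →
      (M? u v →-dec (adj? F u v ×-dec (a u ≟ a v))) ×-dec
      (adj? F u v →-dec (M? u v ⊎-dec adj? G (a u) (a v)))

    preserves? : ∀ H b → Dec (Preserves H b)
    preserves? H b = all? λ u → all? λ v → M? u v →-dec adj? H (b u) (b v)

Marking : SimpleGraph → Set
Marking F = Fin ((2 ^ order F) ^ order F)

Mark : ∀ F → Marking F → Rel (V F) 0ℓ
Mark F = ⟦_⟧ {order F}

mark? : ∀ F (r : Marking F) → Decidable (Mark F r)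
mark? F = ⟦_⟧? {order F}

contractions preservations : ∀ F → Marking F → SimpleGraph → ℕ
contractions  F r G = countMaps (contracts? F (Mark F r) (mark? F r) G)
preservations F r H = countMaps (preserves? F (Mark F r) (mark? F r) H)

module _ (F G H : SimpleGraph) where

  LexHom : (V F → V G) → (V F → V H) → Set
  LexHom a b = ∀ u v → Adj F u v → LexAdj G H (a u , b u) (a v , b v)

  lexHom? : ∀ a b → Dec (LexHom a b)
  lexHom? a b = all? λ u → all? λ v → adj? F u v →-dec
    (((a u ≟ a v) ×-dec adj? H (b u) (b v)) ⊎-dec adj? G (a u) (a v))

  lexHom-extensional : ∀ {a a′ b b′} → a ≗ a′ → b ≗ b′ → LexHom a b → LexHom a′ b′
  lexHom-extensional a≗ b≗ ab-hom u v uv =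
    subst₂ (LexAdj G H) (cong₂ _,_ (a≗ u) (b≗ u)) (cong₂ _,_ (a≗ v) (b≗ v)) (ab-hom u v uv)

  -- The only possible r marks the edges u v of F with a u ≡ a v.
  count-marks : ∀ a b →
    count (λ r → contracts? F (Mark F r) (mark? F r) G a ×-dec preserves? F (Mark F r) (mark? F r) H b)
    ≡ 𝟙 (lexHom? a b)
  count-marks a b = count-unique both? (lexHom? a b) sound unique complete
    where
    both? : U.Decidable λ r → Contracts F (Mark F r) G a × Preserves F (Mark F r) H b
    both? r = contracts? F (Mark F r) (mark? F r) G a ×-dec preserves? F (Mark F r) (mark? F r) H b

    sound : ∀ {r} → Contracts F (Mark F r) G a × Preserves F (Mark F r) H b → LexHom a b
    sound (a-con , b-pres) u v uv with proj₂ (a-con u v) uv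
    ... | inj₁ m = inj₁ (proj₂ (proj₁ (a-con u v) m) , b-pres u v m)
    ... | inj₂ e = inj₂ e

    unique : ∀ {r s} → Contracts F (Mark F r) G a × Preserves F (Mark F r) H b →
      Contracts F (Mark F s) G a × Preserves F (Mark F s) H b → r ≡ s
    unique {r} {s} (r-con , _) (s-con , _) = ⟦⟧-injective {order F} λ u v →
      ⇔-trans (contracts⇒monochromatic F (Mark F r) G r-con u v)
              (⇔-sym (contracts⇒monochromatic F (Mark F s) G s-con u v))

    complete : LexHom a b → ∃ λ r → Contracts F (Mark F r) G a × Preserves F (Mark F r) H b
    complete ab-hom =
      let r , r⇔ = ⟦⟧-surjective {order F} (λ u v → adj? F u v ×-dec (a u ≟ a v))
          open Equivalence
      in r
       , (λ u v → to (r⇔ u v) , λ uv →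
           Data.Sum.map₁ (λ (au≡av , _) → from (r⇔ u v) (uv , au≡av)) (ab-hom u v uv))
       , λ u v m → let uv , au≡av = to (r⇔ u v) m in
           Data.Sum.[ proj₂ , ⊥-elim ∘ irrefl G au≡av ] (ab-hom u v uv)

  hom-· : hom F (G · H) ≡ sum λ r →
    contractions F r G * preservations F r H
  hom-· = begin
    hom F (G · H)
      ≡⟨ hom≡countMaps F (G · H) ⟩
    countMaps (isHom? F (G · H))
      -- Adjacency in `G · H` unfolds to `LexAdj` of the decoded pairs, so the identity equivalence
      -- suffices.
      ≡⟨ sum-cong-≗ {(g * h) ^ o} (λ i → 𝟙-⇔ (⇔-id _) (isHom? F (G · H) (finToFun i)) (lexHom? _ _)) ⟩
    sum (λ (i : Fin ((g * h) ^ o)) →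
      𝟙 (lexHom? (proj₁ ∘ remQuot {g} h ∘ finToFun i) (proj₂ ∘ remQuot {g} h ∘ finToFun i)))
      ≡⟨ sum-mapsToProduct {o} {g} {h} (λ a b → 𝟙 (lexHom? a b)) (λ a≗ b≗ →
           𝟙-⇔ (mk⇔ (lexHom-extensional a≗ b≗) (lexHom-extensional (sym ∘ a≗) (sym ∘ b≗))) (lexHom? _ _) (lexHom? _ _)) ⟩
    sum (λ (i : Fin (g ^ o)) → sum λ (j : Fin (h ^ o)) → 𝟙 (lexHom? (finToFun i) (finToFun j)))
      -- Every admissible pair of maps is charged to its unique marking. Moving the sum over
      -- markings outward then lets the sums over the two maps factor.
      ≡⟨ sum-cong-≗ {g ^ o} (λ i → sum-cong-≗ {h ^ o} λ j → trans
           (sym (count-marks (finToFun i) (finToFun j)))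
           (sum-cong-≗ λ r → 𝟙-× (contracts? F (Mark F r) (mark? F r) G (finToFun i)) (preserves? F (Mark F r) (mark? F r) H (finToFun j)))) ⟩
    sum (λ i → sum λ j → sum λ r → N r i * c r j)
      ≡⟨ sum-cong-≗ (λ i → ∑-comm (λ j r → N r i * c r j)) ⟩
    sum (λ i → sum λ r → sum λ j → N r i * c r j)
      ≡⟨ ∑-comm (λ i r → sum λ j → N r i * c r j) ⟩
    sum (λ r → sum λ i → sum λ j → N r i * c r j)
      ≡⟨ sum-cong-≗ (λ r → sum-* (N r) (c r)) ⟨
    sum (λ r → sum (N r) * sum (c r)) ∎
    where
    open ≡-Reasoning
    o g h : ℕ
    o = order F
    g = order G
    h = order H
    N : Marking F → Fin (g ^ o) → ℕ
    N r i = 𝟙 (contracts? F (Mark F r) (mark? F r) G (finToFun i))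
    c : Marking F → Fin (h ^ o) → ℕ
    c r j = 𝟙 (preserves? F (Mark F r) (mark? F r) H (finToFun j))

-- Contraction counts of connected partitions.

module _ (F : SimpleGraph) (𝓟 : Partition F) (connected : ConnectedParts 𝓟)
         {M : Rel (V F) 0ℓ} (M? : Decidable M)
         (M⇔ : ∀ u v → M u v ⇔ (Adj F u v × part 𝓟 u ≡ part 𝓟 v)) where

  open Equivalence

  -- Every edge inside a part is marked, hence monochromatic under `a`. Walking along such edges
  -- reaches the whole part, as it is connected.
  contracts⇒constant : ∀ G {a} → Contracts F M G a →
    ∀ {u v} → part 𝓟 u ≡ part 𝓟 v → a u ≡ a v
  contracts⇒constant G {a} a-con {u} {v} u~v = along (connected (part 𝓟 v) (u , u~v) (v , refl))
    where
    along : ∀ {p} {x y : Part 𝓟 p} → Star (Adj F on proj₁) x y → a (proj₁ x) ≡ a (proj₁ y)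
    along ε = refl
    along {x = u , u∈p} (_◅_ {j = v , v∈p} uv path) =
      trans (proj₂ (proj₁ (a-con u v) (from (M⇔ u v) (uv , trans u∈p (sym v∈p))))) (along path)

  -- A contracting map is constant on parts, so it factors uniquely through the quotient map `toK`.
  -- The factor is a homomorphism because edges between different parts are unmarked.
  countMaps-contracts : ∀ G {K} → K ≅ F / 𝓟 → countMaps (contracts? F M M? G) ≡ hom K G
  countMaps-contracts G {K} K≅F/𝓟 = sym (trans (hom≡countMaps K G)
    (countMaps-bijection (isHom? K G) (contracts? F M M? G)
      (isHom-extensional K G) (contracts-extensional F M G)
      (_∘ toK) (λ a≗b u → a≗b (toK u)) pullback injective′ push))
    where
    module I = _≅_ K≅F/𝓟
    toK : V F → V K
    toK u = I.from (part 𝓟 u)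

    -- A section of `toK`; composing with it recovers the factor of a map that is constant on parts.
    rep : V K → V F
    rep x = proj₁ (surjective 𝓟 (I.to x))

    part-rep : ∀ x → part 𝓟 (rep x) ≡ I.to x
    part-rep x = proj₂ (surjective 𝓟 (I.to x))

    toK-rep : ∀ x → toK (rep x) ≡ x
    toK-rep x = trans (cong I.from (part-rep x)) (Inverse.strictlyInverseʳ I.bijection x)

    part-rep-toK : ∀ u → part 𝓟 (rep (toK u)) ≡ part 𝓟 u
    part-rep-toK u = trans (part-rep (toK u)) (Inverse.strictlyInverseˡ I.bijection (part 𝓟 u))

    pullback : ∀ {a} → IsHom K G a → Contracts F M G (a ∘ toK)
    pullback {a} a-hom u v = (λ m → map₂ (cong (a ∘ I.from)) (to (M⇔ u v) m)) , cross
      where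
      cross : Adj F u v → M u v ⊎ Adj G (a (toK u)) (a (toK v))
      cross uv with part 𝓟 u ≟ part 𝓟 v
      ... | yes u~v = inj₁ (from (M⇔ u v) (uv , u~v))
      ... | no  u≁v = inj₂ (a-hom (toK u) (toK v) (from (I.adj⇔ (toK u) (toK v))
        (subst₂ (Adj (F / 𝓟))
          (sym (Inverse.strictlyInverseˡ I.bijection (part 𝓟 u)))
          (sym (Inverse.strictlyInverseˡ I.bijection (part 𝓟 v)))
          (u≁v , u , v , refl , refl , uv))))

    injective′ : ∀ {a b} → IsHom K G a → IsHom K G b → a ∘ toK ≗ b ∘ toK → a ≗ b
    injective′ {a} {b} _ _ a≗b x = subst (λ y → a y ≡ b y) (toK-rep x) (a≗b (rep x))

    push : ∀ {b} → Contracts F M G b → ∃ λ a → IsHom K G a × a ∘ toK ≗ b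
    push {b} b-con = b ∘ rep , b-hom , λ u → contracts⇒constant G b-con (part-rep-toK u)
      where
      b-hom : IsHom K G (b ∘ rep)
      b-hom x y xy with to (I.adj⇔ x y) xy
      ... | x≢y , p , q , p∈x , q∈y , pq with proj₂ (b-con p q) pq
      ...   | inj₁ m = contradiction (trans (sym p∈x) (trans (proj₂ (to (M⇔ p q) m)) q∈y)) x≢y
      ...   | inj₂ e = subst₂ (Adj G)
        (contracts⇒constant G b-con (trans p∈x (sym (part-rep x))))
        (contracts⇒constant G b-con (trans q∈y (sym (part-rep y)))) e

-- Connected components of a decidable relation.

module _ {p q : Fin (suc k)} (p≢q : p ≢ q) where

  -- The quotient map identifying `p` with `q`: the index `p` is removed and its elements join those
  -- of `q`.
  merge : Fin (suc k) → Fin k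
  merge c with p ≟ c
  ... | yes _   = punchOut p≢q
  ... | no  p≢c = punchOut p≢c

  merge-punchIn : ∀ d → merge (punchIn p d) ≡ d
  merge-punchIn d with p ≟ punchIn p d
  ... | yes p≡ = contradiction (sym p≡) (punchInᵢ≢i p d)
  ... | no  p≢ = trans (punchOut-cong p refl) (punchOut-punchIn p)

  merge-injective : ∀ {c d} → merge c ≡ merge d → c ≡ d ⊎ (c ≡ p × q ≡ d) ⊎ (c ≡ q × p ≡ d)
  merge-injective {c} {d} eq with p ≟ c | p ≟ d
  ... | yes p≡c | yes p≡d = inj₁ (trans (sym p≡c) p≡d)
  ... | yes p≡c | no  p≢d = inj₂ (inj₁ (sym p≡c , punchOut-injective p≢q p≢d eq))
  ... | no  p≢c | yes p≡d = inj₂ (inj₂ (punchOut-injective p≢c p≢q eq , p≡d))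
  ... | no  p≢c | no  p≢d = inj₁ (punchOut-injective p≢c p≢d eq)

module _ {M : Rel (Fin n) 0ℓ} (M? : Decidable M) where

  -- Starting from singletons, two parts are merged as long as some pair in `M` lies in different
  -- parts. Each merge lowers the number of parts, so this terminates, and parts always stay within
  -- classes of the closure.
  components : ∃ λ k → Σ (Fin n → Fin k) λ part → StrictlySurjective _≡_ part ×
    ∀ u v → part u ≡ part v ⇔ EqClosure M u v
  components = coarsen n id (λ p → p , refl) λ { refl → ε }
    where
    coarsen : ∀ k (part : Fin n → Fin k) → StrictlySurjective _≡_ part →
      (∀ {u v} → part u ≡ part v → EqClosure M u v) →
      ∃ λ k → Σ (Fin n → Fin k) λ part → StrictlySurjective _≡_ part ×
        ∀ u v → part u ≡ part v ⇔ EqClosure M u v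
    coarsen k part surj ≡⇒closure
      with any? (λ u → any? (λ v → M? u v ×-dec ¬? (part u ≟ part v)))
    -- No pair in `M` is separated any more, so equality of parts is an equivalence containing `M`
    -- and hence its closure.
    ... | no ¬split = k , part , surj , λ u v →
      mk⇔ ≡⇒closure (gfold isEquivalence part λ {u} {v} m → M⇒≡ u v m)
      where
      M⇒≡ : ∀ u v → M u v → part u ≡ part v
      M⇒≡ u v m with part u ≟ part v
      ... | yes u~v = u~v
      ... | no  u≁v = contradiction (u , v , m , u≁v) ¬split
    coarsen zero    part _ _ | yes (u , _) with () ← part u
    coarsen (suc k) part surj ≡⇒closure | yes (x , y , m , x≁y) =
      coarsen k (merge x≁y ∘ part)
        (λ d → let u , u∈ = surj (punchIn (part x) d)
               in u , trans (cong (merge x≁y) u∈) (merge-punchIn x≁y d))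
        λ eq → case-merge (merge-injective x≁y eq)
      where
      case-merge : ∀ {u v} → part u ≡ part v ⊎ (part u ≡ part x × part y ≡ part v) ⊎ (part u ≡ part y × part x ≡ part v) →
        EqClosure M u v
      case-merge (inj₁ u~v)                = ≡⇒closure u~v
      case-merge (inj₂ (inj₁ (u~x , y~v))) = ≡⇒closure u~x ◅◅ return m ◅◅ ≡⇒closure y~v
      case-merge (inj₂ (inj₂ (u~y , x~v))) = ≡⇒closure u~y ◅◅ symmetric M (return m) ◅◅ ≡⇒closure x~v

-- Contraction counts of arbitrary markings.

Contraction : SimpleGraph → Set
Contraction F = Σ (Partition F) ConnectedParts

≅-refl : ∀ {G} → G ≅ G
≅-refl = record { bijection = ↔-id _ ; adj⇔ = λ _ _ → ⇔-id _ }

-- The candidate partition is that into components of the marking. The test asks whether the marked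
-- pairs are exactly the edges of `F` inside components. If so, the components are connected in `F`;
-- if not, no map can contract the marking.
contractions-zero-or-hom : ∀ F r →
  (∀ G → contractions F r G ≡ 0) ⊎ (Σ (Contraction F) λ (𝓟 , _) → ∀ G → contractions F r G ≡ hom (F / 𝓟) G)
contractions-zero-or-hom F r with components (mark? F r)
... | k , part , surj , part⇔ with all? (λ u → all? (λ v →
        (mark? F r u v →-dec (adj? F u v ×-dec (part u ≟ part v))) ×-dec
        ((adj? F u v ×-dec (part u ≟ part v)) →-dec mark? F r u v)))
...   | yes flat = inj₂ ((𝓟 , connected) , λ G → countMaps-contracts F 𝓟 connected (mark? F r) M⇔ G ≅-refl)
  where
  𝓟 : Partition F
  𝓟 = record { size = k ; part = part ; surjective = surj }

  M⇔ : ∀ u v → Mark F r u v ⇔ (Adj F u v × part u ≡ part v)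
  M⇔ u v = mk⇔ (proj₁ (flat u v)) (proj₂ (flat u v))

  step : ∀ {u v} → SymClosure (Mark F r) u v → Adj F u v × part u ≡ part v
  step {u} {v} (fwd m) = proj₁ (flat u v) m
  step {u} {v} (bwd m) = let vu , v~u = proj₁ (flat v u) m in symm F vu , sym v~u

  -- A marked pair, read in either direction, is an edge of `F` that stays in its part, so the whole
  -- path remains in `p`.
  lift : ∀ {p u v} → EqClosure (Mark F r) u v → (u∈p : part u ≡ p) (v∈p : part v ≡ p) →
    Star {I = Part 𝓟 p} (Adj F on proj₁) (u , u∈p) (v , v∈p)
  lift ε        refl refl = ε
  lift (m ◅ ms) u∈p  v∈p  =
    let uw , u~w = step m in uw ◅ lift ms (trans (sym u~w) u∈p) v∈p

  connected : ConnectedParts 𝓟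
  connected p (u , u∈p) (v , v∈p) =
    lift (Equivalence.to (part⇔ u v) (trans u∈p (sym v∈p))) u∈p v∈p
...   | no ¬flat = inj₁ λ G → count-none (λ i → contracts? F (Mark F r) (mark? F r) G (finToFun i))
        λ i a-con → ¬flat λ u v → flat G a-con u v
  where
  flat : ∀ G {a} → Contracts F (Mark F r) G a → ∀ u v →
    (Mark F r u v → Adj F u v × part u ≡ part v) × (Adj F u v × part u ≡ part v → Mark F r u v)
  flat G {a} a-con u v =
    -- A contracting map is constant on components, so an edge inside a component is monochromatic
    -- and must be marked.
    (λ m → proj₁ (to (mono u v) m) , from (part⇔ u v) (return m)) ,
    λ (uv , u~v) → from (mono u v)
      (uv , gfold isEquivalence a (λ {x} {y} m → proj₂ (to (mono x y) m)) (to (part⇔ u v) u~v))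
    where
    open Equivalence
    mono = contracts⇒monochromatic F (Mark F r) G a-con

-- The categorical product and multiplicativity.

infixl 7 _⊗_

_⊗_ : SimpleGraph → SimpleGraph → SimpleGraph
G ⊗ H = record
  { order  = order G * order H
  ; Adj    = TensorAdj on remQuot {order G} (order H)
  ; adj?   = λ x y → adj? G (π₁ x) (π₁ y) ×-dec adj? H (π₂ x) (π₂ y)
  ; symm   = λ (gg′ , hh′) → symm G gg′ , symm H hh′
  ; irrefl = λ { refl (gg , _) → irrefl G refl gg }
  }
  where
  TensorAdj : Rel (V G × V H) 0ℓ
  TensorAdj (g , h) (g′ , h′) = Adj G g g′ × Adj H h h′

  π₁ : Fin (order G * order H) → V G
  π₁ = proj₁ ∘ remQuot {order G} (order H)

  π₂ : Fin (order G * order H) → V H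
  π₂ = proj₂ ∘ remQuot {order G} (order H)

remQuot-injective : ∀ {x y : Fin (m * n)} → remQuot {m} n x ≡ remQuot n y → x ≡ y
remQuot-injective {m} {n} {x} {y} eq =
  trans (sym (combine-remQuot {m} n x)) (trans (cong (λ (i , j) → combine i j) eq) (combine-remQuot {m} n y))

hom-⊗ : ∀ F G H → hom F (G ⊗ H) ≡ hom F G * hom F H
hom-⊗ F G H = begin
  hom F (G ⊗ H)
    ≡⟨ hom≡countMaps F (G ⊗ H) ⟩
  countMaps (isHom? F (G ⊗ H))
    ≡⟨ countMaps-× (isHom? F G) (isHom? F H) (isHom? F (G ⊗ H))
         (isHom-extensional F G) (isHom-extensional F H) (λ f → mk⇔
           (λ f-hom → (λ u v uv → proj₁ (f-hom u v uv)) , λ u v uv → proj₂ (f-hom u v uv))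
           (λ (f₁-hom , f₂-hom) u v uv → f₁-hom u v uv , f₂-hom u v uv)) ⟩
  countMaps (isHom? F G) * countMaps (isHom? F H)
    ≡⟨ cong₂ _*_ (hom≡countMaps F G) (hom≡countMaps F H) ⟨
  hom F G * hom F H ∎
  where open ≡-Reasoning

-- Equality and adjacency in `G ⊗ H` are componentwise. The alternative "marked or sent to an edge"
-- also splits, because the marking is the same for both factors.
contractions-⊗ : ∀ F r G H → contractions F r (G ⊗ H) ≡ contractions F r G * contractions F r H
contractions-⊗ F r G H =
  countMaps-× (contracts? F M (mark? F r) G) (contracts? F M (mark? F r) H) (contracts? F M (mark? F r) (G ⊗ H))
    (contracts-extensional F M G) (contracts-extensional F M H) λ f → mk⇔ (split f) (join f)
  where
  M = Mark F r

  fst : V (G ⊗ H) → V G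
  fst = proj₁ ∘ remQuot {order G} (order H)

  snd : V (G ⊗ H) → V H
  snd = proj₂ ∘ remQuot {order G} (order H)

  split : ∀ f → Contracts F M (G ⊗ H) f → Contracts F M G (fst ∘ f) × Contracts F M H (snd ∘ f)
  split f f-con =
    (λ u v → map₂ (cong fst) ∘ proj₁ (f-con u v) , Data.Sum.map₂ proj₁ ∘ proj₂ (f-con u v)) ,
    (λ u v → map₂ (cong snd) ∘ proj₁ (f-con u v) , Data.Sum.map₂ proj₂ ∘ proj₂ (f-con u v))

  both : {C : Set} → C ⊎ A → C ⊎ B → C ⊎ (A × B)
  both (inj₁ c) _        = inj₁ c
  both (inj₂ _) (inj₁ c) = inj₁ c
  both (inj₂ a) (inj₂ b) = inj₂ (a , b)

  join : ∀ f → Contracts F M G (fst ∘ f) × Contracts F M H (snd ∘ f) → Contracts F M (G ⊗ H) f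
  join f (f₁-con , f₂-con) u v =
    (λ m → let uv , eq₁ = proj₁ (f₁-con u v) m
               _  , eq₂ = proj₁ (f₂-con u v) m
           in uv , remQuot-injective {order G} {order H} (cong₂ _,_ eq₁ eq₂)) ,
    λ uv → both (proj₂ (f₁-con u v) uv) (proj₂ (f₂-con u v) uv)

-- Squares of differences and weighted sums.

-- The binomial formula for the square of `x - y`, arranged to avoid negative terms. Writing the
-- larger number as the smaller plus `d` makes it a polynomial identity.
2xy+∣x-y∣²≡x²+y² : ∀ x y → (x * y + y * x) + ∣ x - y ∣ * ∣ x - y ∣ ≡ x * x + y * y
2xy+∣x-y∣²≡x²+y² x y with ≤-total x y
... | inj₁ x≤y with d , refl ← m≤n⇒∃[o]m+o≡n x≤y rewrite ∣m-m+n∣≡n x d =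
    solve 2 (λ x d → (x :* (x :+ d) :+ (x :+ d) :* x) :+ d :* d := x :* x :+ (x :+ d) :* (x :+ d)) refl x d
    where open +-*-Solver
... | inj₂ y≤x with d , refl ← m≤n⇒∃[o]m+o≡n y≤x rewrite ∣-∣-comm (y + d) y | ∣m-m+n∣≡n y d =
    solve 2 (λ y d → ((y :+ d) :* y :+ y :* (y :+ d)) :+ d :* d := (y :+ d) :* (y :+ d) :+ y :* y) refl y d
    where open +-*-Solver

2xy≤x²+y² : ∀ x y → x * y + y * x ≤ x * x + y * y
2xy≤x²+y² x y = subst (x * y + y * x ≤_) (2xy+∣x-y∣²≡x²+y² x y) (m≤m+n _ _)

2xy≡x²+y²⇒x≡y : ∀ x y → x * y + y * x ≡ x * x + y * y → x ≡ y
2xy≡x²+y²⇒x≡y x y eq =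
  ∣m-n∣≡0⇒m≡n (Data.Sum.reduce (m*n≡0⇒m≡0∨n≡0 ∣ x - y ∣
    (+-cancelˡ-≡ (x * y + y * x) _ _
      (trans (2xy+∣x-y∣²≡x²+y² x y) (trans (sym eq) (sym (+-identityʳ _)))))))

-- The difference of the two hypotheses says that the sum of (x i − y i)² * w i vanishes.
weighted-sums-separate : (w x y : Fin n → ℕ) →
  sum (λ i → (x i * x i) * w i) ≡ sum (λ i → (y i * x i) * w i) →
  sum (λ i → (x i * y i) * w i) ≡ sum (λ i → (y i * y i) * w i) →
  ∀ i → NonZero (w i) → x i ≡ y i
weighted-sums-separate w x y xx≡yx xy≡yy i w≢0 =
  2xy≡x²+y²⇒x≡y (x i) (y i) (*-cancelʳ-≡ _ _ (w i) {{w≢0}}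
    (sum-≤-≡ (λ j → *-monoˡ-≤ (w j) (2xy≤x²+y² (x j) (y j))) sums i))
  where
  open ≡-Reasoning
  split : ∀ {n} (s t w : Fin n → ℕ) →
    sum (λ j → (s j + t j) * w j) ≡ sum (λ j → s j * w j) + sum (λ j → t j * w j)
  split s t w = trans (sum-cong-≗ λ j → *-distribʳ-+ (w j) (s j) (t j)) (∑-distrib-+ (λ j → s j * w j) (λ j → t j * w j))

  sums : sum (λ j → (x j * y j + y j * x j) * w j) ≡ sum (λ j → (x j * x j + y j * y j) * w j)
  sums = begin
    sum (λ j → (x j * y j + y j * x j) * w j)
      ≡⟨ split (λ j → x j * y j) (λ j → y j * x j) w ⟩
    sum (λ j → (x j * y j) * w j) + sum (λ j → (y j * x j) * w j)
      ≡⟨ cong₂ _+_ xy≡yy (sym xx≡yx) ⟩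
    sum (λ j → (y j * y j) * w j) + sum (λ j → (x j * x j) * w j)
      ≡⟨ +-comm (sum λ j → (y j * y j) * w j) _ ⟩
    sum (λ j → (x j * x j) * w j) + sum (λ j → (y j * y j) * w j)
      ≡⟨ split (λ j → x j * x j) (λ j → y j * y j) w ⟨
    sum (λ j → (x j * x j + y j * y j) * w j) ∎

-- The implications between the three assertions.

module _ {ℓ} {𝓕 : Pred SimpleGraph ℓ} where

  ⊗-preserves-≡ : ∀ G G′ → G ≡[ 𝓕 ] G′ → ∀ H → G ⊗ H ≡[ 𝓕 ] G′ ⊗ H
  ⊗-preserves-≡ G G′ G≡G′ H F F∈𝓕 =
    trans (hom-⊗ F G H) (trans (cong (_* hom F H) (G≡G′ F F∈𝓕)) (sym (hom-⊗ F G′ H)))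

  closed⇒preserved : ClosedUnderEdgeContractions 𝓕 → PreservedUnderRightLexProducts 𝓕
  closed⇒preserved closed G G′ H G≡G′ F F∈𝓕 = begin
    hom F (G · H)                                           ≡⟨ hom-· F G H ⟩
    sum (λ r → contractions F r G * preservations F r H)    ≡⟨ sum-cong-≗ (λ r → cong (_* preservations F r H) (same r)) ⟩
    sum (λ r → contractions F r G′ * preservations F r H)   ≡⟨ hom-· F G′ H ⟨
    hom F (G′ · H)                                          ∎
    where
    open ≡-Reasoning
    same : ∀ r → contractions F r G ≡ contractions F r G′
    same r with contractions-zero-or-hom F r
    ... | inj₁ zero′ = trans (zero′ G) (sym (zero′ G′))
    ... | inj₂ ((𝓟 , connected) , hom′) = trans (hom′ G)
      (trans (G≡G′ (F / 𝓟) (closed F F∈𝓕 𝓟 connected (F / 𝓟) ≅-refl)) (sym (hom′ G′)))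

  preserved⇒cl-closed : PreservedUnderRightLexProducts 𝓕 → ClosedUnderEdgeContractions (cl 𝓕)
  preserved⇒cl-closed preserved F F∈cl 𝓟 connected K K≅F/𝓟 G G′ G≡G′ = begin
    hom K G              ≡⟨ countMaps-contracts F 𝓟 connected (mark? F r) M⇔ G K≅F/𝓟 ⟨
    contractions F r G   ≡⟨ weighted-sums-separate (λ s → preservations F s F) (λ s → contractions F s G) (λ s → contractions F s G′)
                              (weighted G) (weighted G′) r preservations≢0 ⟩
    contractions F r G′  ≡⟨ countMaps-contracts F 𝓟 connected (mark? F r) M⇔ G′ K≅F/𝓟 ⟩
    hom K G′             ∎
    where
    open ≡-Reasoning
    -- The marking of the edges inside the parts of `𝓟`, for which the contraction count is `hom K`.
    marking = ⟦⟧-surjective {order F} (λ u v → adj? F u v ×-dec (part 𝓟 u ≟ part 𝓟 v))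
    r  = proj₁ marking
    M⇔ = proj₂ marking

    -- The identity on `F` is a witness, because marked pairs are edges of `F`.
    preservations≢0 : NonZero (preservations F r F)
    preservations≢0 = count-nonZero (λ i → preserves? F (Mark F r) (mark? F r) F (finToFun i)) {funToFin {order F} id}
      λ u v m → subst₂ (Adj F) (sym (finToFun-funToFin id u)) (sym (finToFun-funToFin id v)) (proj₁ (Equivalence.to (M⇔ u v) m))

    expand : ∀ X Y → hom F ((X ⊗ Y) · F) ≡ sum λ s → (contractions F s X * contractions F s Y) * preservations F s F
    expand X Y = trans (hom-· F (X ⊗ Y) F)
      (sum-cong-≗ λ s → cong (_* preservations F s F) (contractions-⊗ F s X Y))

    -- With `X` set to `G` and to `G′` this gives the two equations that force the squared
    -- differences to vanish.
    weighted : ∀ X →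
      sum (λ s → (contractions F s G * contractions F s X) * preservations F s F) ≡
      sum (λ s → (contractions F s G′ * contractions F s X) * preservations F s F)
    weighted X = trans (sym (expand G X)) (trans
      (F∈cl ((G ⊗ X) · F) ((G′ ⊗ X) · F)
        (preserved (G ⊗ X) (G′ ⊗ X) F (⊗-preserves-≡ G G′ G≡G′ X)))
      (expand G′ X))

theorem15 : ∀ {ℓ} (𝓕 : Pred SimpleGraph ℓ) →
    (ClosedUnderEdgeContractions 𝓕 → PreservedUnderRightLexProducts 𝓕)
    × (PreservedUnderRightLexProducts 𝓕 ⇔ ClosedUnderEdgeContractions (cl 𝓕))
theorem15 𝓕 = closed⇒preserved , mk⇔ preserved⇒cl-closed cl-closed⇒preserved
  where
  cl-closed⇒preserved : ClosedUnderEdgeContractions (cl 𝓕) → PreservedUnderRightLexProducts 𝓕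
  cl-closed⇒preserved closed G G′ H G≡G′ F F∈𝓕 =
    -- The first implication is applied to `cl 𝓕` in place of `𝓕`. This is legitimate since `𝓕` is
    -- contained in `cl 𝓕` and both classes induce the same equivalence of graphs.
    closed⇒preserved closed G G′ H (λ K K∈cl → K∈cl G G′ G≡G′) F (λ _ _ X≡Y → X≡Y F F∈𝓕)
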